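{- There exist problems $P$ and $Q$ such that there is no problem $S$ with the following property: for all problems $R$, $R \leq_c S$ if and only if $R$ is computably reducible to $Q$ followed by $P$.
   Context: A problem $P : \subseteq \omega^\omega \rightrightarrows \omega^\omega$ is a partial multi-function taking $\omega$-valued sequences to sets of $\omega$-valued sequences: it has a domain $\mathrm{dom}(P) \subseteq \omega^\omega$, whose elements are called the instances of $P$ (or $P$-instances), and to each $X \in \mathrm{dom}(P)$ it assigns a set $P(X) \subseteq \omega^\omega$, whose elements are called the $P$-solutions of $X$. Write $\leq_T$ for Turing reducibility and $\oplus$ for the Turing join. Computable reducibility: for problems $P$ and $Q$, $P \leq_c Q$ means that for every $X \in \mathrm{dom}(P)$ there is $\widehat{X} \in \mathrm{dom}(Q)$ with $\widehat{X} \leq_T X$ such that for every $\widehat{Y} \in Q(\widehat{X})$ there is $Y \in P(X)$ with $Y \leq_T X \oplus \widehat{Y}$. For problems $P$, $Q$, $R$, we say that $R$ is computably reducible to $Q$ followed by $P$ if for every $R$-instance $X$ there is a $Q$-instance $\widehat{X} \leq_T X$ such that for every $Q$-solution $\widehat{Y}$ of $\widehat{X}$ there is a $P$-instance $Z \leq_T X \oplus \widehat{Y}$ such that for every $P$-solution $W$ of $Z$ there is an $R$-solution $Y$ of $X$ with $Y \leq_T X \oplus \widehat{Y} \oplus W$. -}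

module Defs where

open import Data.Fin.Base using (Fin)
open import Data.Nat.Base using (ℕ; zero; suc; _<_)
open import Data.Product.Base using (∃; ∃-syntax; _×_)
open import Data.Vec.Base using (Vec; []; _∷_; lookup)
open import Data.Vec.Relation.Binary.Pointwise.Inductive using (Pointwise)
open import Function.Base using (_∘_)
open import Level using (0ℓ)
open import Relation.Binary.Core using (REL)
open import Relation.Binary.Definitions using (_Respects_; _Respects₂_)
open import Relation.Binary.PropositionalEquality using (_≗_)
open import Relation.Unary using (Pred)

Baire : Set
Baire = ℕ → ℕ

infix  4 _⊢_⟨_⟩⇓_ _≤T_ _≤c_ _≤c_followedBy_
infixl 6 _⊕_

-- Kleene's schemes for the partial functions ℕⁿ ⇀ ℕ that are recursive in an
-- oracle; `query` is the oracle itself.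
data Prog : ℕ → Set where
  zer   : ∀ {n} → Prog n
  succ  : Prog 1
  proj  : ∀ {n} → Fin n → Prog n
  query : Prog 1
  comp  : ∀ {m n} → Prog m → Vec (Prog n) m → Prog n
  rec   : ∀ {n} → Prog n → Prog (suc (suc n)) → Prog (suc n)
  mu    : ∀ {n} → Prog (suc n) → Prog n

-- O ⊢ p ⟨ xs ⟩⇓ y : with oracle O, the program p halts on xs with value y.
data _⊢_⟨_⟩⇓_ (O : Baire) : ∀ {n} → Prog n → Vec ℕ n → ℕ → Set where
  zer⇓   : ∀ {n} {xs : Vec ℕ n} → O ⊢ zer ⟨ xs ⟩⇓ 0
  succ⇓  : ∀ {x} → O ⊢ succ ⟨ x ∷ [] ⟩⇓ suc x
  proj⇓  : ∀ {n} {i : Fin n} {xs} → O ⊢ proj i ⟨ xs ⟩⇓ lookup xs i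
  query⇓ : ∀ {x} → O ⊢ query ⟨ x ∷ [] ⟩⇓ O x
  comp⇓  : ∀ {m n} {f : Prog m} {gs : Vec (Prog n) m} {xs ys z} →
           Pointwise (λ g y → O ⊢ g ⟨ xs ⟩⇓ y) gs ys →
           O ⊢ f ⟨ ys ⟩⇓ z →
           O ⊢ comp f gs ⟨ xs ⟩⇓ z
  rec⇓₀  : ∀ {n} {f : Prog n} {g xs z} →
           O ⊢ f ⟨ xs ⟩⇓ z →
           O ⊢ rec f g ⟨ 0 ∷ xs ⟩⇓ z
  rec⇓₊  : ∀ {n} {f : Prog n} {g xs k y z} →
           O ⊢ rec f g ⟨ k ∷ xs ⟩⇓ y →
           O ⊢ g ⟨ k ∷ y ∷ xs ⟩⇓ z →
           O ⊢ rec f g ⟨ suc k ∷ xs ⟩⇓ z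
  mu⇓    : ∀ {n} {f : Prog (suc n)} {xs y} →
           O ⊢ f ⟨ y ∷ xs ⟩⇓ 0 →
           (∀ k → k < y → ∃[ v ] O ⊢ f ⟨ k ∷ xs ⟩⇓ suc v) →
           O ⊢ mu f ⟨ xs ⟩⇓ y

_≤T_ : Baire → Baire → Set
X ≤T Y = ∃[ p ] ∀ n → Y ⊢ p ⟨ n ∷ [] ⟩⇓ X n

-- (X ⊕ Y)(2n) = X(n) and (X ⊕ Y)(2n+1) = Y(n).
_⊕_ : Baire → Baire → Baire
(X ⊕ Y) zero          = X zero
(X ⊕ Y) (suc zero)    = Y zero
(X ⊕ Y) (suc (suc n)) = ((X ∘ suc) ⊕ (Y ∘ suc)) n

-- Equality in Baire space is pointwise, so subsets of it are the predicates
-- that respect _≗_. The values of `sol` outside `dom` play no role, and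
-- instances need not have solutions.
record Problem : Set₁ where
  field
    dom      : Pred Baire 0ℓ
    sol      : REL Baire Baire 0ℓ
    dom-resp : dom Respects _≗_
    sol-resp : sol Respects₂ _≗_

open Problem public

_≤c_ : Problem → Problem → Set
P ≤c Q =
  ∀ X → dom P X →
  ∃[ X̂ ] dom Q X̂ × X̂ ≤T X ×
  (∀ Ŷ → sol Q X̂ Ŷ →
   ∃[ Y ] sol P X Y × Y ≤T X ⊕ Ŷ)

_≤c_followedBy_ : Problem → Problem → Problem → Set
R ≤c Q followedBy P =
  ∀ X → dom R X →
  ∃[ X̂ ] dom Q X̂ × X̂ ≤T X ×
  (∀ Ŷ → sol Q X̂ Ŷ →
   ∃[ Z ] dom P Z × Z ≤T X ⊕ Ŷ ×
   (∀ W → sol P Z W →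
    ∃[ Y ] sol R X Y × Y ≤T X ⊕ Ŷ ⊕ W))

{-# OPTIONS --safe #-}
-- Let Yₑ and c_z be mutually generic reals, let Q accept any of the Yₑ as a
-- solution, and let P map an instance starting with z to c_z. If S represented
-- "Q followed by P", then the e-th computable S-instance would have a solution
-- computable from Yₑ ⊕ c_b for some b. Let R be solved by the reals
-- Yₑ ⊕ c_(b + 1), with b depending on e in this way. It reduces to Q followed
-- by P, as a reduction may choose the P-instance non-uniformly. But if it
-- reduced to S by the e-th computable instance, Yₑ ⊕ c_b would compute either
-- some Yⱼ with j ≠ e or c_(b + 1), contradicting genericity.
module Submission where

open import Axiom.ExcludedMiddle using (ExcludedMiddle)
open import Data.Fin.Base using (zero; suc; toℕ; fromℕ<)
open import Data.Fin.Properties using (toℕ<n; fromℕ<-toℕ)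
open import Data.Nat.Base
open import Data.Nat.Properties
open import Data.Product.Base using (∃; ∃-syntax; _×_; _,_; proj₁; proj₂)
open import Data.Product.Properties using (,-injective)
open import Data.Sum.Base using (inj₁; inj₂)
open import Data.Unit.Base using (⊤; tt)
open import Data.Vec.Base using (Vec; []; _∷_)
open import Data.Vec.Relation.Binary.Pointwise.Inductive using (Pointwise; []; _∷_)
open import Function.Base using (_∘_; const)
open import Function.Bundles using (_⇔_; Equivalence)
open import Level using (0ℓ)
open import Relation.Binary.Definitions using (tri<; tri≈; tri>)
open import Relation.Binary.PropositionalEquality hiding ([_])
open import Relation.Nullary.Decidable.Core using (Dec; yes; no)
open import Relation.Nullary.Negation using (¬_; contradiction)
open import Relation.Unary using (Pred)
open import Defs

-- Oracle computations

⇓-cast : ∀ {O n} {p : Prog n} {xs y z} → y ≡ z → O ⊢ p ⟨ xs ⟩⇓ y → O ⊢ p ⟨ xs ⟩⇓ z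
⇓-cast refl d = d

⇓-det : ∀ {O n} {p : Prog n} {xs y z} → O ⊢ p ⟨ xs ⟩⇓ y → O ⊢ p ⟨ xs ⟩⇓ z → y ≡ z
⇓*-det : ∀ {O m n} {gs : Vec (Prog n) m} {xs ys zs} →
         Pointwise (λ g y → O ⊢ g ⟨ xs ⟩⇓ y) gs ys →
         Pointwise (λ g y → O ⊢ g ⟨ xs ⟩⇓ y) gs zs → ys ≡ zs
0≢∃suc : ∀ {O n} {p : Prog n} {xs} →
         O ⊢ p ⟨ xs ⟩⇓ 0 → ¬ (∃[ v ] O ⊢ p ⟨ xs ⟩⇓ suc v)

⇓-det zer⇓ zer⇓ = refl
⇓-det succ⇓ succ⇓ = refl
⇓-det proj⇓ proj⇓ = refl
⇓-det query⇓ query⇓ = refl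
⇓-det (comp⇓ ds d) (comp⇓ es e) with refl ← ⇓*-det ds es = ⇓-det d e
⇓-det (rec⇓₀ d) (rec⇓₀ e) = ⇓-det d e
⇓-det (rec⇓₊ d d′) (rec⇓₊ e e′) with refl ← ⇓-det d e = ⇓-det d′ e′
⇓-det (mu⇓ {y = y} d ds) (mu⇓ {y = z} e es) with <-cmp y z
... | tri< y<z _ _ = contradiction (es y y<z) (0≢∃suc d)
... | tri≈ _ y≡z _ = y≡z
... | tri> _ _ z<y = contradiction (ds z z<y) (0≢∃suc e)

⇓*-det [] [] = refl
⇓*-det (d ∷ ds) (e ∷ es) = cong₂ _∷_ (⇓-det d e) (⇓*-det ds es)

0≢∃suc d (_ , e) with () ← ⇓-det d e

Agree : ℕ → Baire → Baire → Set
Agree u X Y = ∀ n → n < u → X n ≡ Y n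

-- `D` contains a basic neighbourhood of `O`; when `D` says that a computation halts, `u` bounds its
-- use.
Near : Baire → Pred Baire 0ℓ → Set
Near O D = ∃[ u ] ∀ O′ → Agree u O O′ → D O′

near-const : ∀ {O} {D : Pred Baire 0ℓ} → (∀ O′ → D O′) → Near O D
near-const d = 0 , λ O′ _ → d O′

near-map : ∀ {O} {D E : Pred Baire 0ℓ} → (∀ {O′} → D O′ → E O′) → Near O D → Near O E
near-map f (u , d) = u , λ O′ a → f (d O′ a)

near-map₂ : ∀ {O} {D E F : Pred Baire 0ℓ} → (∀ {O′} → D O′ → E O′ → F O′) →
            Near O D → Near O E → Near O F
near-map₂ f (u , d) (v , e) = u ⊔ v , λ O′ a →
  f (d O′ λ n n<u → a n (<-≤-trans n<u (m≤m⊔n u v)))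
    (e O′ λ n n<v → a n (<-≤-trans n<v (m≤n⊔m u v)))

near-∀< : ∀ {O} y {D : ℕ → Pred Baire 0ℓ} → (∀ k → k < y → Near O (D k)) →
          Near O (λ O′ → ∀ k → k < y → D k O′)
near-∀< zero d = near-const λ _ _ ()
near-∀< (suc y) {D} d = near-map₂ snoc (near-∀< y λ k k<y → d k (m<n⇒m<1+n k<y)) (d y ≤-refl)
  where
  snoc : ∀ {O′} → (∀ k → k < y → D k O′) → D y O′ → ∀ k → k < suc y → D k O′
  snoc ds d′ k k<1+y with m<1+n⇒m<n∨m≡n k<1+y
  ... | inj₁ k<y = ds k k<y
  ... | inj₂ refl = d′

-- The use principle: a halting computation asks the oracle only finitely many questions.
use : ∀ {O n} {p : Prog n} {xs y} → O ⊢ p ⟨ xs ⟩⇓ y → Near O (λ O′ → O′ ⊢ p ⟨ xs ⟩⇓ y)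
use* : ∀ {O m n} {gs : Vec (Prog n) m} {xs ys} →
       Pointwise (λ g y → O ⊢ g ⟨ xs ⟩⇓ y) gs ys →
       Near O (λ O′ → Pointwise (λ g y → O′ ⊢ g ⟨ xs ⟩⇓ y) gs ys)
use-suc : ∀ {O n} {p : Prog n} {xs} → ∃[ v ] O ⊢ p ⟨ xs ⟩⇓ suc v →
          Near O (λ O′ → ∃[ v ] O′ ⊢ p ⟨ xs ⟩⇓ suc v)

use zer⇓ = near-const λ _ → zer⇓
use succ⇓ = near-const λ _ → succ⇓
use proj⇓ = near-const λ _ → proj⇓
use (query⇓ {x}) = suc x , λ O′ a → ⇓-cast (sym (a x ≤-refl)) query⇓
use (comp⇓ ds d) = near-map₂ comp⇓ (use* ds) (use d)
use (rec⇓₀ d) = near-map rec⇓₀ (use d)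
use (rec⇓₊ d e) = near-map₂ rec⇓₊ (use d) (use e)
use (mu⇓ {y = y} d ds) = near-map₂ mu⇓ (use d) (near-∀< y λ k k<y → use-suc (ds k k<y))

use* [] = near-const λ _ → []
use* (d ∷ ds) = near-map₂ _∷_ (use d) (use* ds)

use-suc (v , d) = near-map (v ,_) (use d)

-- Turing reducibility

infixl 8 _[_] _[_]*

-- Running a program for the oracle in place of each query composes reductions.
_[_] : ∀ {n} → Prog n → Prog 1 → Prog n
_[_]* : ∀ {m n} → Vec (Prog n) m → Prog 1 → Vec (Prog n) m
zer [ q ] = zer
succ [ q ] = succ
proj i [ q ] = proj i
query [ q ] = q
comp f gs [ q ] = comp (f [ q ]) (gs [ q ]*)
rec f g [ q ] = rec (f [ q ]) (g [ q ])
mu f [ q ] = mu (f [ q ])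
[] [ q ]* = []
(g ∷ gs) [ q ]* = g [ q ] ∷ gs [ q ]*

module _ {O O′ : Baire} {q : Prog 1} (q⇓ : ∀ n → O′ ⊢ q ⟨ n ∷ [] ⟩⇓ O n) where

  []⇓ : ∀ {n} {p : Prog n} {xs y} → O ⊢ p ⟨ xs ⟩⇓ y → O′ ⊢ p [ q ] ⟨ xs ⟩⇓ y
  []*⇓ : ∀ {m n} {gs : Vec (Prog n) m} {xs ys} →
         Pointwise (λ g y → O ⊢ g ⟨ xs ⟩⇓ y) gs ys →
         Pointwise (λ g y → O′ ⊢ g ⟨ xs ⟩⇓ y) (gs [ q ]*) ys
  []-suc⇓ : ∀ {n} {p : Prog n} {xs} → ∃[ v ] O ⊢ p ⟨ xs ⟩⇓ suc v →
            ∃[ v ] O′ ⊢ p [ q ] ⟨ xs ⟩⇓ suc v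

  []⇓ zer⇓ = zer⇓
  []⇓ succ⇓ = succ⇓
  []⇓ proj⇓ = proj⇓
  []⇓ (query⇓ {x}) = q⇓ x
  []⇓ (comp⇓ ds d) = comp⇓ ([]*⇓ ds) ([]⇓ d)
  []⇓ (rec⇓₀ d) = rec⇓₀ ([]⇓ d)
  []⇓ (rec⇓₊ d e) = rec⇓₊ ([]⇓ d) ([]⇓ e)
  []⇓ (mu⇓ d ds) = mu⇓ ([]⇓ d) λ k k<y → []-suc⇓ (ds k k<y)

  []*⇓ [] = []
  []*⇓ (d ∷ ds) = []⇓ d ∷ []*⇓ ds

  []-suc⇓ (v , d) = v , []⇓ d

≤T-trans : ∀ {X Y Z} → X ≤T Y → Y ≤T Z → X ≤T Z
≤T-trans (p , p⇓) (q , q⇓) = p [ q ] , λ n → []⇓ q⇓ (p⇓ n)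

≤T-refl : ∀ {X} → X ≤T X
≤T-refl = query , λ _ → query⇓

≤T-respˡ : ∀ {X X′ Y} → X ≗ X′ → X ≤T Y → X′ ≤T Y
≤T-respˡ X≗X′ (p , p⇓) = p , λ n → ⇓-cast (X≗X′ n) (p⇓ n)

const-≤T : ∀ z {Y} → const z ≤T Y
const-≤T zero = zer , λ _ → zer⇓
const-≤T (suc z) with p , p⇓ ← const-≤T z = comp succ (p ∷ []) , λ n → comp⇓ (p⇓ n ∷ []) succ⇓

rec⇓ : ∀ {O n} {f : Prog n} {g xs} (F : ℕ → ℕ) → O ⊢ f ⟨ xs ⟩⇓ F 0 →
       (∀ k → O ⊢ g ⟨ k ∷ F k ∷ xs ⟩⇓ F (suc k)) → ∀ k → O ⊢ rec f g ⟨ k ∷ xs ⟩⇓ F k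
rec⇓ F d e zero = rec⇓₀ d
rec⇓ F d e (suc k) = rec⇓₊ (rec⇓ F d e k) (e k)

double : ℕ → ℕ
double zero = zero
double (suc n) = suc (suc (double n))

doubleP : Prog 1
doubleP = rec zer (comp succ (comp succ (proj (suc zero) ∷ []) ∷ []))

doubleP⇓ : ∀ {O} n → O ⊢ doubleP ⟨ n ∷ [] ⟩⇓ double n
doubleP⇓ = rec⇓ double zer⇓ λ _ → comp⇓ (comp⇓ (proj⇓ ∷ []) succ⇓ ∷ []) succ⇓

⊕-double : ∀ X Y n → (X ⊕ Y) (double n) ≡ X n
⊕-double X Y zero = refl
⊕-double X Y (suc n) = ⊕-double (X ∘ suc) (Y ∘ suc) n

⊕-suc-double : ∀ X Y n → (X ⊕ Y) (suc (double n)) ≡ Y n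
⊕-suc-double X Y zero = refl
⊕-suc-double X Y (suc n) = ⊕-suc-double (X ∘ suc) (Y ∘ suc) n

⊕-upperˡ : ∀ {X Y} → X ≤T X ⊕ Y
⊕-upperˡ {X} {Y} = ≤T-respˡ (⊕-double X Y)
  (comp query (doubleP ∷ []) , λ n → comp⇓ (doubleP⇓ n ∷ []) query⇓)

⊕-upperʳ : ∀ {X Y} → Y ≤T X ⊕ Y
⊕-upperʳ {X} {Y} = ≤T-respˡ (⊕-suc-double X Y)
  (comp query (comp succ (doubleP ∷ []) ∷ []) ,
   λ n → comp⇓ (comp⇓ (doubleP⇓ n ∷ []) succ⇓ ∷ []) query⇓)

ifz : ℕ → ℕ → ℕ → ℕ
ifz zero x y = x
ifz (suc _) x y = y

mod2 : ℕ → ℕ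
mod2 zero = 0
mod2 (suc zero) = 1
mod2 (suc (suc n)) = mod2 n

mod2-suc : ∀ n → ifz (mod2 n) 1 0 ≡ mod2 (suc n)
mod2-suc zero = refl
mod2-suc (suc zero) = refl
mod2-suc (suc (suc n)) = mod2-suc n

suc-ifz : ∀ k x y → suc (ifz k x y) ≡ ifz k (suc x) (suc y)
suc-ifz zero x y = refl
suc-ifz (suc _) x y = refl

-- The half grows exactly when passing from an odd number, so parity yields a primitive recursion
-- for it.
half-suc : ∀ n → ifz (mod2 n) ⌊ n /2⌋ (suc ⌊ n /2⌋) ≡ ⌊ suc n /2⌋
half-suc zero = refl
half-suc (suc zero) = refl
half-suc (suc (suc n)) = trans (sym (suc-ifz (mod2 n) _ _)) (cong suc (half-suc n))

⊕-mod2-half : ∀ X Y n → ifz (mod2 n) (X ⌊ n /2⌋) (Y ⌊ n /2⌋) ≡ (X ⊕ Y) n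
⊕-mod2-half X Y zero = refl
⊕-mod2-half X Y (suc zero) = refl
⊕-mod2-half X Y (suc (suc n)) = ⊕-mod2-half (X ∘ suc) (Y ∘ suc) n

-- Case distinction is a primitive recursion whose step has the same value for every counter and
-- previous value.
ifz⇓ : ∀ {O n} {f : Prog n} {g xs u v} → O ⊢ f ⟨ xs ⟩⇓ u →
       (∀ k y → O ⊢ g ⟨ k ∷ y ∷ xs ⟩⇓ v) → ∀ b → O ⊢ rec f g ⟨ b ∷ xs ⟩⇓ ifz b u v
ifz⇓ {u = u} {v} d e = rec⇓ (λ b → ifz b u v) d λ k → e k _

mod2P : Prog 1
mod2P = rec zer (comp (rec (comp succ (zer ∷ [])) zer) (proj (suc zero) ∷ []))

mod2P⇓ : ∀ {O} n → O ⊢ mod2P ⟨ n ∷ [] ⟩⇓ mod2 n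
mod2P⇓ = rec⇓ mod2 zer⇓ λ k → comp⇓ (proj⇓ ∷ [])
  (⇓-cast (mod2-suc k) (ifz⇓ (comp⇓ (zer⇓ ∷ []) succ⇓) (λ _ _ → zer⇓) (mod2 k)))

halfP : Prog 1
halfP = rec zer (comp (rec (proj zero) (comp succ (proj (suc (suc zero)) ∷ [])))
                      (comp mod2P (proj zero ∷ []) ∷ proj (suc zero) ∷ []))

halfP⇓ : ∀ {O} n → O ⊢ halfP ⟨ n ∷ [] ⟩⇓ ⌊ n /2⌋
halfP⇓ = rec⇓ ⌊_/2⌋ zer⇓ λ k → comp⇓ (comp⇓ (proj⇓ ∷ []) (mod2P⇓ k) ∷ proj⇓ ∷ [])
  (⇓-cast (half-suc k)
    (ifz⇓ proj⇓ (λ _ _ → comp⇓ (proj⇓ ∷ []) succ⇓) (mod2 k)))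

⊕-least : ∀ {X Y Z} → X ≤T Z → Y ≤T Z → X ⊕ Y ≤T Z
⊕-least {X} {Y} (p , p⇓) (q , q⇓) = ≤T-respˡ (⊕-mod2-half X Y)
  ( comp (rec p (comp q (proj (suc (suc zero)) ∷ []))) (mod2P ∷ halfP ∷ [])
  , λ n → comp⇓ (mod2P⇓ n ∷ halfP⇓ n ∷ [])
      (ifz⇓ (p⇓ ⌊ n /2⌋) (λ _ _ → comp⇓ (proj⇓ ∷ []) (q⇓ ⌊ n /2⌋)) (mod2 n)))

-- Enumerations

Enumeration : Set → Set
Enumeration A = ∃ λ (f : ℕ → A) → ∀ a → ∃[ n ] f n ≡ a

-- Cantor's walk: down each antidiagonal to first coordinate 0, then to the start of the next one.
next : ℕ × ℕ → ℕ × ℕ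
next (suc a , b) = a , suc b
next (zero , b) = suc b , zero

unpair : ℕ → ℕ × ℕ
unpair zero = zero , zero
unpair (suc n) = next (unpair n)

unpair-walk : ∀ a b → ∃[ n ] unpair n ≡ (b + a , 0) → ∃[ n ] unpair n ≡ (a , b)
unpair-walk a zero start = start
unpair-walk a (suc b) (m , eq)
  with n , eq′ ← unpair-walk (suc a) b (m , trans eq (cong (_, 0) (sym (+-suc b a))))
  = suc n , cong next eq′

unpair-onto-axis : ∀ s → ∃[ n ] unpair n ≡ (s , 0)
unpair-onto-axis zero = 0 , refl
unpair-onto-axis (suc s)
  with m , eq ← unpair-onto-axis s
  with n , eq′ ← unpair-walk 0 s (m , trans eq (cong (_, 0) (sym (+-identityʳ s))))
  = suc n , cong next eq′

unpair-onto : ∀ a b → ∃[ n ] unpair n ≡ (a , b)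
unpair-onto a b = unpair-walk a b (unpair-onto-axis (b + a))

-- Abstract so that the arguments of a pairing can be inferred by unification.
abstract
  pair : ℕ → ℕ → ℕ
  pair a b = proj₁ (unpair-onto a b)

  unpair-pair : ∀ a b → unpair (pair a b) ≡ (a , b)
  unpair-pair a b = proj₂ (unpair-onto a b)

pair-injective : ∀ {a b c d} → pair a b ≡ pair c d → a ≡ c × b ≡ d
pair-injective {a} {b} {c} {d} eq = ,-injective
  (trans (sym (unpair-pair a b)) (trans (cong unpair eq) (unpair-pair c d)))

×-enumeration : ∀ {A B} → Enumeration A → Enumeration B → Enumeration (A × B)
×-enumeration (f , f-onto) (g , g-onto) =
  (λ n → f (proj₁ (unpair n)) , g (proj₂ (unpair n))) , onto
  where
  onto : ∀ ab → ∃[ n ] (f (proj₁ (unpair n)) , g (proj₂ (unpair n))) ≡ ab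
  onto (a , b) with m , refl ← f-onto a | n , refl ← g-onto b =
    pair m n , cong (λ xy → f (proj₁ xy) , g (proj₂ xy)) (unpair-pair m n)

ℕ-enumeration : Enumeration ℕ
ℕ-enumeration = (λ n → n) , λ n → n , refl

-- Untyped codes for programs of every arity and for vectors of programs, so that only trees need
-- numbering.
data Tree : Set where
  leaf : ℕ → Tree
  node : Tree → Tree → Tree

code : Tree → ℕ
code (leaf n) = pair 0 n
code (node s t) = pair 1 (pair (code s) (code t))

code-injective : ∀ {s t} → code s ≡ code t → s ≡ t
code-injective {leaf _} {leaf _} eq = cong leaf (proj₂ (pair-injective eq))
code-injective {leaf _} {node _ _} eq with () ← proj₁ (pair-injective eq)
code-injective {node _ _} {leaf _} eq with () ← proj₁ (pair-injective eq)
code-injective {node _ _} {node _ _} eq =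
  let eqˡ , eqʳ = pair-injective (proj₂ (pair-injective eq)) in
  cong₂ node (code-injective eqˡ) (code-injective eqʳ)

Tree-enumeration : ExcludedMiddle 0ℓ → Enumeration Tree
Tree-enumeration em = (λ n → pick n em) , λ t → code t , pick-code t em
  where
  -- Excluded middle decides whether `n` is a code, which replaces an explicit inverse of `code`.
  pick : ∀ n → Dec (∃[ t ] code t ≡ n) → Tree
  pick n (yes (t , _)) = t
  pick n (no _) = leaf 0

  pick-code : ∀ t d → pick (code t) d ≡ t
  pick-code t (yes (_ , eq)) = code-injective eq
  pick-code t (no ¬∃) = contradiction (t , refl) ¬∃

encode : ∀ {n} → Prog n → Tree
encode* : ∀ {m n} → Vec (Prog n) m → Tree
encode zer = leaf 0
encode succ = leaf 1
encode query = leaf 2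
encode (proj i) = leaf (3 + toℕ i)
encode (mu f) = node (leaf 0) (encode f)
encode (rec f g) = node (leaf 1) (node (encode f) (encode g))
-- The inner arity `m` is not determined by `n`, so the label records it, shifted past the tags of
-- `mu` and `rec`.
encode (comp {m} f gs) = node (leaf (2 + m)) (node (encode f) (encode* gs))
encode* [] = leaf 0
encode* (g ∷ gs) = node (encode g) (encode* gs)

projection : ∀ i n → Dec (i < n) → Prog n
projection i n (yes i<n) = proj (fromℕ< i<n)
projection i n (no _) = zer

projection-toℕ : ∀ {n} i (d : Dec (toℕ i < n)) → projection (toℕ i) n d ≡ proj i
projection-toℕ i (yes i<n) = cong proj (fromℕ<-toℕ i i<n)
projection-toℕ i (no i≮n) = contradiction (toℕ<n i) i≮n

-- Trees that encode no program of the given arity decode to zer.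
decode : Tree → ∀ n → Prog n
decode* : Tree → ∀ m n → Vec (Prog n) m
decode (leaf 1) 1 = succ
decode (leaf 2) 1 = query
decode (leaf (suc (suc (suc i)))) n = projection i n (i <? n)
decode (node (leaf 0) t) n = mu (decode t (suc n))
decode (node (leaf 1) (node s t)) (suc n) = rec (decode s n) (decode t (2 + n))
decode (node (leaf (suc (suc m))) (node s t)) n = comp (decode s m) (decode* t m n)
decode _ n = zer
decode* _ zero n = []
decode* (node s t) (suc m) n = decode s n ∷ decode* t m n
decode* (leaf _) (suc m) n = zer ∷ decode* (leaf 0) m n

decode-encode : ∀ {n} (p : Prog n) → decode (encode p) n ≡ p
decode*-encode* : ∀ {m n} (gs : Vec (Prog n) m) → decode* (encode* gs) m n ≡ gs
decode-encode zer = refl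
decode-encode succ = refl
decode-encode query = refl
decode-encode (proj i) = projection-toℕ i (toℕ i <? _)
decode-encode (mu f) = cong mu (decode-encode f)
decode-encode (rec f g) = cong₂ rec (decode-encode f) (decode-encode g)
decode-encode (comp f gs) = cong₂ comp (decode-encode f) (decode*-encode* gs)
decode*-encode* [] = refl
decode*-encode* (g ∷ gs) = cong₂ _∷_ (decode-encode g) (decode*-encode* gs)

Prog-enumeration : ExcludedMiddle 0ℓ → ∀ n → Enumeration (Prog n)
Prog-enumeration em n with f , onto ← Tree-enumeration em =
  (λ k → decode (f k) n) , λ p → let k , eq = onto (encode p) in
  k , trans (cong (λ t → decode t n) eq) (decode-encode p)

-- Generic sequences of reals

-- A condition fixes, in every column of its stem, the values below its height.
record Condition : Set where
  constructor _↾_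
  field
    stem   : ℕ → Baire
    height : ℕ

open Condition

infix 4 _⊏_

_⊏_ : Condition → (ℕ → Baire) → Set
c ⊏ G = ∀ i → Agree (height c) (stem c i) (G i)

-- `Φ` contains a dense open set, the basic open sets being the extensions of conditions. The strict
-- growth of heights ensures that a chain of conditions fixes every value.
Dense : Pred (ℕ → Baire) 0ℓ → Set
Dense Φ = ∀ c → ∃[ c′ ] height c < height c′ × c ⊏ stem c′ × (∀ G → c′ ⊏ G → Φ G)

-- The Baire category argument: a chain of conditions meets the dense sets one after another.
generic : (Φ : ℕ → Pred (ℕ → Baire) 0ℓ) → (∀ n → Dense (Φ n)) → ∃[ G ] ∀ n → Φ n G
generic Φ dense = G , λ n → proj₂ (proj₂ (proj₂ (dense n (c n)))) G (c⊏G (suc n))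
  where
  c : ℕ → Condition
  c zero = (λ _ _ → 0) ↾ 0
  c (suc n) = proj₁ (dense n (c n))

  G : ℕ → Baire
  -- `c (suc x)` has height above `x`, so row `x` is settled by then.
  G i x = stem (c (suc x)) i x

  height-suc : ∀ n → height (c n) < height (c (suc n))
  height-suc n = proj₁ (proj₂ (dense n (c n)))

  n≤height : ∀ n → n ≤ height (c n)
  n≤height zero = z≤n
  n≤height (suc n) = ≤-<-trans (n≤height n) (height-suc n)

  coherent : ∀ {m n} → m ≤′ n → c m ⊏ stem (c n) × height (c m) ≤ height (c n)
  coherent ≤′-refl = (λ _ _ _ → refl) , ≤-refl
  coherent (≤′-step {n} m≤n) with agree , h≤ ← coherent m≤n =
    (λ i x x< → trans (agree i x x<)
      (proj₁ (proj₂ (proj₂ (dense n (c n)))) i x (<-≤-trans x< h≤))) ,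
    ≤-trans h≤ (<⇒≤ (height-suc n))

  c⊏G : ∀ n → c n ⊏ G
  -- Whichever of `c n` and `c (suc x)` comes first already fixes row `x`, and the other one
  -- preserves it.
  c⊏G n i x x< with ≤-total n (suc x)
  ... | inj₁ n≤ = proj₁ (coherent (≤⇒≤′ n≤)) i x x<
  ... | inj₂ ≤n = sym (proj₁ (coherent (≤⇒≤′ ≤n)) i x (n≤height (suc x)))

⊕-agree : ∀ {u} n {X X′ Y Y′} → n < u → Agree u X X′ → Agree u Y Y′ → (X ⊕ Y) n ≡ (X′ ⊕ Y′) n
⊕-agree zero n<u aX aY = aX 0 n<u
⊕-agree (suc zero) n<u aX aY = aY 0 (<⇒≤ n<u)
⊕-agree {suc u} (suc (suc n)) n<u aX aY =
  ⊕-agree n (<⇒≤ (≤-pred n<u)) (λ k k<u → aX (suc k) (s≤s k<u)) (λ k k<u → aY (suc k) (s≤s k<u))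

override : (ℕ → Baire) → ℕ → ℕ → ℕ → (ℕ → Baire)
override h i N v l n with l ≟ i | n ≟ N
... | yes _ | yes _ = v
... | _ | _ = h l n

override-at : ∀ h i N v → override h i N v i N ≡ v
override-at h i N v with i ≟ i | N ≟ N
... | yes _ | yes _ = refl
... | no i≢i | _ = contradiction refl i≢i
... | yes _ | no N≢N = contradiction refl N≢N

override-column : ∀ h i N v {l} → i ≢ l → ∀ n → h l n ≡ override h i N v l n
override-column h i N v {l} i≢l n with l ≟ i | n ≟ N
... | yes l≡i | _ = contradiction (sym l≡i) i≢l
... | no _ | yes _ = refl
... | no _ | no _ = refl

override-row : ∀ h i N v l {n} → n ≢ N → h l n ≡ override h i N v l n
override-row h i N v l {n} n≢N with l ≟ i | n ≟ N
... | _ | yes n≡N = contradiction n≡N n≢N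
... | yes _ | no _ = refl
... | no _ | no _ = refl

Avoids : Prog 1 × ℕ × ℕ × ℕ → Pred (ℕ → Baire) 0ℓ
Avoids (p , i , j , k) G = i ≢ j → i ≢ k → ¬ (∀ n → G j ⊕ G k ⊢ p ⟨ n ∷ [] ⟩⇓ G i n)

-- Diagonalization at `N`, the first row left open by the condition. Either no extension makes `p`
-- halt there, or the value of one such computation is contradicted in column `i`, which is not part
-- of the oracle.
avoids-dense : ExcludedMiddle 0ℓ → ∀ r → Dense (Avoids r)
avoids-dense em (p , i , j , k) c@(g ↾ N)
  with em {∃[ h ] c ⊏ h × ∃[ y ] h j ⊕ h k ⊢ p ⟨ N ∷ [] ⟩⇓ y}
-- Only the height grows: a `G` with `p` halting at `N` would itself be the excluded extension.
... | no ¬halts = (g ↾ suc N) , ≤-refl , (λ _ _ _ → refl) , λ G c′⊏G _ _ G⇓ →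
  ¬halts (G , (λ l n n<N → c′⊏G l n (m<n⇒m<1+n n<N)) , G i N , G⇓ N)
... | yes (h , c⊏h , y , d) with u , d-near ← use d =
  -- The height covers both the altered entry in row `N` and the use `u` of the computation.
  (h′ ↾ (suc N ⊔ u)) , m≤m⊔n (suc N) u ,
  (λ l n n<N → trans (c⊏h l n n<N) (override-row h i N (suc y) l (<⇒≢ n<N))) ,
  λ G c′⊏G i≢j i≢k G⇓ →
    let agree : ∀ {l} → i ≢ l → Agree u (h l) (G l)
        agree i≢l n n<u = trans (override-column h i N (suc y) i≢l n)
          (c′⊏G _ n (<-≤-trans n<u (m≤n⊔m (suc N) u)))
        y≡ : y ≡ G i N
        y≡ = ⇓-det (d-near (G j ⊕ G k) λ n n<u → ⊕-agree n n<u (agree i≢j) (agree i≢k)) (G⇓ N)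
        1+y≡ : suc y ≡ G i N
        1+y≡ = trans (sym (override-at h i N (suc y))) (c′⊏G i N (m≤m⊔n (suc N) u))
    in 1+n≢n (trans 1+y≡ (sym y≡))
  where
  h′ = override h i N (suc y)

Independent : Pred (ℕ → Baire) 0ℓ
Independent G = ∀ i j k → i ≢ j → i ≢ k → ¬ (G i ≤T G j ⊕ G k)

∃-independent : ExcludedMiddle 0ℓ → ∃ Independent
∃-independent em
  with req , onto ← ×-enumeration (Prog-enumeration em 1)
                      (×-enumeration ℕ-enumeration (×-enumeration ℕ-enumeration ℕ-enumeration))
  with G , avoids ← generic (Avoids ∘ req) (avoids-dense em ∘ req)
  = G , λ i j k i≢j i≢k (p , p⇓) →
    let n , eq = onto (p , i , j , k) in
    subst (λ r → Avoids r G) eq (avoids n) i≢j i≢k p⇓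

-- The problems `P` and `Q`, and diagonalization against a given `S`

≤c-refl : ∀ P → P ≤c P
≤c-refl P X dX = X , dX , ≤T-refl , λ Y sY → Y , sY , ⊕-upperʳ

module Counterexample (em : ExcludedMiddle 0ℓ) (G : ℕ → Baire) (independent : Independent G) where

  y c : ℕ → Baire
  y e = G (suc (2 * e))
  c z = G (2 * z)

  y≰T : ∀ {e j b} → j ≢ e → ¬ (y j ≤T y e ⊕ c b)
  y≰T {e} {j} {b} j≢e = independent (suc (2 * j)) (suc (2 * e)) (2 * b)
    (λ eq → j≢e (*-cancelˡ-≡ j e 2 (suc-injective eq)))
    (λ eq → even≢odd b j (sym eq))

  c≰T : ∀ {e a b} → a ≢ b → ¬ (c a ≤T y e ⊕ c b)
  c≰T {e} {a} {b} a≢b = independent (2 * a) (suc (2 * e)) (2 * b)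
    (even≢odd a e) (a≢b ∘ *-cancelˡ-≡ a b 2)

  P Q : Problem
  P = record
    { dom = λ _ → ⊤
    ; sol = λ Z W → W ≗ c (Z 0)
    ; dom-resp = λ _ _ → tt
    ; sol-resp = (λ W≗W′ s n → trans (sym (W≗W′ n)) (s n))
               , (λ Z≗Z′ s n → trans (s n) (cong (λ z → c z n) (Z≗Z′ 0)))
    }
  Q = record
    { dom = λ _ → ⊤
    ; sol = λ _ Ŷ → ∃[ e ] Ŷ ≗ y e
    ; dom-resp = λ _ _ → tt
    ; sol-resp = (λ Y≗Y′ (e , s) → e , λ n → trans (sym (Y≗Y′ n)) (s n)) , λ _ s → s
    }

  R : (ℕ → ℕ) → Problem
  R F = record
    { dom = λ _ → ⊤
    ; sol = λ _ U → ∃[ e ] U ≗ y e ⊕ c (F e)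
    ; dom-resp = λ _ _ → tt
    ; sol-resp = (λ U≗U′ (e , s) → e , λ n → trans (sym (U≗U′ n)) (s n)) , λ _ s → s
    }

  R≤c : ∀ F → R F ≤c Q followedBy P
  R≤c F X _ = X , tt , ≤T-refl , λ Ŷ (e , Ŷ≗) →
    -- `F` need not be computable: `e` is fixed at this point, and every constant sequence is
    -- computable.
    const (F e) , tt , const-≤T (F e) , λ W W≗ →
    y e ⊕ c (F e) , (e , λ _ → refl) ,
    ⊕-least (≤T-respˡ Ŷ≗ (≤T-trans ⊕-upperʳ ⊕-upperˡ)) (≤T-respˡ W≗ ⊕-upperʳ)

  module _ (S : Problem) (S≤c : S ≤c Q followedBy P) where

    prog : ℕ → Prog 1
    prog = proj₁ (Prog-enumeration em 1)

    -- The oracle `const 0` stands for no oracle. Quantifying over `X̂` inside gives the notion a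
    -- meaning even if `prog e` is not total.
    Beaten : ℕ → ℕ → Set
    Beaten e b = ∃[ X̂ ] ∃[ V ]
      (∀ n → const 0 ⊢ prog e ⟨ n ∷ [] ⟩⇓ X̂ n) × sol S X̂ V × V ≤T y e ⊕ c b

    -- Taking the decision as an argument lets `avoid-beaten` recover the very `b` that `F` avoids.
    -- The default 0 occurs only when there is no `b` to avoid.
    avoid : ∀ {e} → Dec (∃ (Beaten e)) → ℕ
    avoid (yes (b , _)) = suc b
    avoid (no _) = 0

    avoid-beaten : ∀ {e} (d : Dec (∃ (Beaten e))) → ∃ (Beaten e) → ∃[ b ] Beaten e b × avoid d ≢ b
    avoid-beaten (yes (b , beaten)) _ = b , beaten , 1+n≢n
    avoid-beaten (no ¬beaten) beaten = contradiction beaten ¬beaten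

    F : ℕ → ℕ
    F e = avoid (em {∃ (Beaten e)})

    -- In the reduction of `S`, let `y e` answer `Q`; the resulting `P`-instance `Z` gives
    -- `b = Z 0`. As `X̂` is computable, it drops out of the oracle.
    beaten : ∀ {X̂ e} → dom S X̂ → (∀ n → const 0 ⊢ prog e ⟨ n ∷ [] ⟩⇓ X̂ n) → ∃ (Beaten e)
    beaten {X̂} {e} dX̂ e⇓
      with _ , _ , _ , k ← S≤c X̂ dX̂
      with Z , _ , _ , l ← k (y e) (e , λ _ → refl)
      with V , sV , V≤ ← l (c (Z 0)) (λ _ → refl)
      = Z 0 , X̂ , V , e⇓ , sV , ≤T-trans V≤
          (⊕-least (⊕-least (≤T-trans (prog e , e⇓) (const-≤T 0)) ⊕-upperˡ) ⊕-upperʳ)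

    R≰c : ¬ (R F ≤c S)
    R≰c R≤S
      -- A computable `R F`-instance forces `X̂` to be computable, hence given by some `prog e`.
      with X̂ , dX̂ , (p , p⇓) , solve ← R≤S (const 0) tt
      with e , refl ← proj₂ (Prog-enumeration em 1) p
      with b , (X̂′ , V , X̂′⇓ , sV , V≤) , Fe≢b ← avoid-beaten (em {∃ (Beaten e)}) (beaten dX̂ p⇓)
      -- `X̂′` and `X̂` are outputs of the same program, so `V` also solves `X̂`.
      with U , (j , U≗) , U≤ ← solve V (proj₂ (sol-resp S) (λ n → ⇓-det (X̂′⇓ n) (p⇓ n)) sV)
      with y⊕c≤ ← ≤T-respˡ U≗ (≤T-trans U≤ (⊕-least (const-≤T 0) V≤))
      -- The solution `U` may belong to another index `j`: then its half `y j` is out of reach;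
      -- otherwise its half `c (F e)` is, since `F e` differs from `b`.
      with j ≟ e
    ... | no j≢e = y≰T {b = b} j≢e (≤T-trans ⊕-upperˡ y⊕c≤)
    ... | yes refl = c≰T {e} Fe≢b (≤T-trans ⊕-upperʳ y⊕c≤)

theorem3p2 : ExcludedMiddle 0ℓ → ∃[ P ] ∃[ Q ] ¬ (∃[ S ] (∀ (R : Problem) → (R ≤c S) ⇔ (R ≤c Q followedBy P)))
theorem3p2 em with G , independent ← ∃-independent em =
  P , Q , λ (S , iff) →
    -- Reflexivity puts `S` itself among the problems reducible to `S`, so `S` reduces to `Q`
    -- followed by `P`.
    let S≤c = Equivalence.to (iff S) (≤c-refl S)
    in R≰c S S≤c (Equivalence.from (iff (R (F S S≤c))) (R≤c (F S S≤c)))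
  where open Counterexample em G independent
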